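{- For any positive increasing function $\phi$ with $\phi(X)\to\infty$ as $X\to\infty$, there exists a set $A\subset\mathbb{N}$ such that the set $A^2+A$ has density $1$ and $$\liminf_{X\to\infty} \frac{A(X)}{(X\phi(X))^{1/3}}<\infty.$$
   Context: $\mathbb{N}$ is the set of positive integers. $A^2=\{ab: a,b\in A\}$, $A^2+A=\{x+y: x\in A^2, y\in A\}$. For a set $S$ of nonnegative integers, $S(X)=|S\cap[1,X]|$; $S$ has density $1$ if $\lim_{X\to\infty} S(X)/X = 1$. -}

module Defs where

open import Data.Empty using (⊥-elim)
open import Data.Integer.Base using (+_; -[1+_]; +<+)
open import Data.List.Base using (applyUpTo; filter; length)
open import Data.Nat.Base as ℕ using (ℕ; zero; suc)
import Data.Nat.Properties as ℕ
open import Data.Product.Base using (_×_; _,_; ∃; ∃₂; ∃-syntax; Σ-syntax)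
open import Data.Rational.Base
open import Data.Rational.Properties
open import Data.Sum.Base using (_⊎_; inj₁; inj₂; [_,_]′)
open import Function.Base using (_∘_)
open import Level using (0ℓ)
open import Relation.Binary.Definitions using (tri<; tri≈; tri>)
open import Relation.Binary.PropositionalEquality
  using (_≡_; refl; sym; trans; cong; subst; subst₂)
open import Relation.Nullary using (yes; no)
open import Relation.Nullary.Decidable using (map′; _×-dec_)
open import Relation.Unary using (Pred; Decidable)

private
  Op : Set
  Op = ℕ → ℕ → ℕ

-- Membership is decidable, so that counting functions can be computed;
-- classically this is no restriction.
record ℕ⁺Set : Set₁ where
  field
    Member   : Pred ℕ 0ℓ
    member?  : Decidable Member
    nonZero⁺ : ∀ {n} → Member n → ℕ.NonZero n

open ℕ⁺Set

infix 4 _∈_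
_∈_ : ℕ → ℕ⁺Set → Set
n ∈ A = Member A n

private
  decImage : (_∙_ : Op) →
             (∀ a b .{{_ : ℕ.NonZero b}} → a ℕ.≤ a ∙ b) →
             (∀ a b .{{_ : ℕ.NonZero a}} → b ℕ.≤ a ∙ b) →
             (A B : ℕ⁺Set) →
             Decidable (λ n → ∃₂ λ a b → a ∈ A × b ∈ B × a ∙ b ≡ n)
  decImage _∙_ le₁ le₂ A B n =
    map′ (λ (a , _ , b , _ , p) → a , b , p)
         (λ where
           (a , b , a∈A , b∈B , refl) →
             a , ℕ.s≤s (le₁ a b {{nonZero⁺ B b∈B}}) ,
             b , ℕ.s≤s (le₂ a b {{nonZero⁺ A a∈A}}) , a∈A , b∈B , refl)
         (ℕ.anyUpTo? (λ a → ℕ.anyUpTo? (λ b →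
            member? A a ×-dec member? B b ×-dec (a ∙ b) ℕ.≟ n) (suc n)) (suc n))

infixl 7 _·_
_·_ : ℕ⁺Set → ℕ⁺Set → ℕ⁺Set
A · B = record
  { Member   = λ n → ∃₂ λ a b → a ∈ A × b ∈ B × a ℕ.* b ≡ n
  ; member?  = decImage ℕ._*_ ℕ.m≤m*n (λ a b → ℕ.m≤n*m b a) A B
  ; nonZero⁺ = λ where
      (a , b , a∈A , b∈B , refl) →
        ℕ.m*n≢0 a b {{nonZero⁺ A a∈A}} {{nonZero⁺ B b∈B}}
  }

infixl 6 _⊕_
_⊕_ : ℕ⁺Set → ℕ⁺Set → ℕ⁺Set
A ⊕ B = record
  { Member   = λ n → ∃₂ λ a b → a ∈ A × b ∈ B × a ℕ.+ b ≡ n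
  ; member?  = decImage ℕ._+_ (λ a b → ℕ.m≤m+n a b) (λ a b → ℕ.m≤n+m b a) A B
  ; nonZero⁺ = λ where
      (a , b , a∈A , b∈B , refl) →
        ℕ.>-nonZero (ℕ.<-≤-trans (ℕ.>-nonZero⁻¹ a {{nonZero⁺ A a∈A}})
                                 (ℕ.m≤m+n a b))
  }

infix 8 _²
_² : ℕ⁺Set → ℕ⁺Set
A ² = A · A

-- |S ∩ [1,X]|: applyUpTo suc X is the list 1, 2, …, X.
count : ℕ⁺Set → ℕ → ℕ
count S X = length (filter (member? S) (applyUpTo suc X))

Seq : ∀ {ℓ} → Set ℓ → Set ℓ
Seq T = (X : ℕ) → .{{_ : ℕ.NonZero X}} → T

_Converges-to_ : Seq ℚ → ℚ → Set
a Converges-to l =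
  ∀ (ε : ℚ) → 0ℚ < ε →
  ∃[ N ] ∀ X .{{_ : ℕ.NonZero X}} → N ℕ.≤ X → ∣ a X - l ∣ < ε

HasDensityOne : ℕ⁺Set → Set
HasDensityOne S = (λ X → + count S X / X) Converges-to 1ℚ

-- Two-sided Dedekind cuts: Lower x q means q < x and Upper x q means x < q.
record ℝ : Set₁ where
  field
    Lower Upper : Pred ℚ 0ℓ
    lower-inhabited : ∃ Lower
    upper-inhabited : ∃ Upper
    lower-closed    : ∀ {q r} → q < r → Lower r → Lower q
    upper-closed    : ∀ {q r} → q < r → Upper q → Upper r
    lower-open      : ∀ {q} → Lower q → ∃[ r ] q < r × Lower r
    upper-open      : ∀ {r} → Upper r → ∃[ q ] q < r × Upper q
    disjoint        : ∀ {q r} → Lower q → Upper r → q < r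
    located         : ∀ {q r} → q < r → Lower q ⊎ Upper r

open ℝ

record ℝ⁺ : Set₁ where
  field
    real : ℝ
    0<real : Lower real 0ℚ

open ℝ⁺

infix 4 _≤ᵣ_
_≤ᵣ_ : ℝ → ℝ → Set
x ≤ᵣ y = ∀ {q} → Lower x q → Lower y q

private
  upper>0 : ∀ (y : ℝ⁺) {s} → Upper (real y) s → 0ℚ < s
  upper>0 y u = disjoint (real y) (0<real y) u

  *-monoˡ-< : ∀ {r} → 0ℚ < r → ∀ {p q} → p < q → p * r < q * r
  *-monoˡ-< {r} 0<r = *-monoˡ-<-pos r {{positive 0<r}}

  *-cancelʳ-< : ∀ {r} → 0ℚ < r → ∀ {p q} → p * r < q * r → p < q
  *-cancelʳ-< {r} 0<r = *-cancelʳ-<-pos r (positive 0<r)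

  *-monoʳ-< : ∀ {r} → 0ℚ < r → ∀ {p q} → p < q → r * p < r * q
  *-monoʳ-< {r} 0<r = *-monoʳ-<-pos r {{positive 0<r}}

  *-monoʳ-≤ : ∀ {r} → 0ℚ ≤ r → ∀ {p q} → p ≤ q → r * p ≤ r * q
  *-monoʳ-≤ {r} 0≤r = *-monoˡ-≤-nonNeg r {{nonNegative 0≤r}}

  *-pos : ∀ {p q} → 0ℚ < p → 0ℚ < q → 0ℚ < p * q
  *-pos {p} {q} 0<p 0<q = subst (_< p * q) (*-zeroˡ q) (*-monoˡ-< 0<q 0<p)

  1/⁺ : ∀ s → 0ℚ < s → ∃[ i ] 0ℚ < i × i * s ≡ 1ℚ
  1/⁺ s 0<s = 1/ s , positive⁻¹ (1/ s) {{1/pos⇒pos s}} , *-inverseˡ s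
    where instance
      s⁺ = positive 0<s
      s≢0 = pos⇒nonZero s

  divide : ∀ p {s} → 0ℚ < s → ∃[ t ] t * s ≡ p
  divide p {s} 0<s with i , _ , is≡1 ← 1/⁺ s 0<s =
    p * i , trans (*-assoc p i s) (trans (cong (p *_) is≡1) (*-identityʳ p))

  pos-quotient : ∀ {t s p} → 0ℚ < s → 0ℚ < p → t * s ≡ p → 0ℚ < t
  pos-quotient {t} {s} 0<s 0<p refl =
    *-cancelʳ-< 0<s (subst (_< t * s) (sym (*-zeroˡ s)) 0<p)

  p<p+1 : ∀ p → p < p + 1ℚ
  p<p+1 p = subst (_< p + 1ℚ) (+-identityʳ p) (+-monoʳ-< p (positive⁻¹ 1ℚ))

  p-1<p : ∀ p → p - 1ℚ < p
  p-1<p p = subst (p - 1ℚ <_) (+-identityʳ p) (+-monoʳ-< p (negative⁻¹ (- 1ℚ)))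

private
  1/ₙ>0 : ∀ n .{{_ : ℕ.NonZero n}} → 0ℚ < + 1 / n
  1/ₙ>0 n = positive⁻¹ (+ 1 / n) {{normalize-pos 1 n}}

infixr 7 _·ᵣ_
_·ᵣ_ : (n : ℕ) .{{_ : ℕ.NonZero n}} → ℝ⁺ → ℝ⁺
n ·ᵣ y = record
  { real = record
    { Lower = λ q → Lower x (q * c)
    ; Upper = λ q → Upper x (q * c)
    ; lower-inhabited =
        let q , l = lower-inhabited x ; t , e = divide q 0<c
        in t , subst (Lower x) (sym e) l
    ; upper-inhabited =
        let q , u = upper-inhabited x ; t , e = divide q 0<c
        in t , subst (Upper x) (sym e) u
    ; lower-closed = λ q<r → lower-closed x (*-monoˡ-< 0<c q<r)
    ; upper-closed = λ q<r → upper-closed x (*-monoˡ-< 0<c q<r)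
    ; lower-open = λ l →
        let r , q<r , l′ = lower-open x l ; t , e = divide r 0<c
        in t , *-cancelʳ-< 0<c (subst (_ <_) (sym e) q<r)
             , subst (Lower x) (sym e) l′
    ; upper-open = λ u →
        let q , q<r , u′ = upper-open x u ; t , e = divide q 0<c
        in t , *-cancelʳ-< 0<c (subst (_< _) (sym e) q<r)
             , subst (Upper x) (sym e) u′
    ; disjoint = λ l u → *-cancelʳ-< 0<c (disjoint x l u)
    ; located = λ q<r → located x (*-monoˡ-< 0<c q<r)
    }
  ; 0<real = subst (Lower x) (sym (*-zeroˡ c)) (0<real y)
  }
  where
    x = real y
    c = + 1 / n
    0<c = 1/ₙ>0 n

cube : ℚ → ℚ
cube q = q * (q * q)

private
  cube-neg : ∀ q → cube (- q) ≡ - cube q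
  cube-neg q =
    trans (sym (neg-distribˡ-* q (- q * - q)))
      (cong (λ z → - (q * z))
        (trans (sym (neg-distribˡ-* q (- q)))
          (trans (cong -_ (sym (neg-distribʳ-* q q))) (neg-involutive′ (q * q)))))
    where
      neg-involutive′ : ∀ p → - - p ≡ p
      neg-involutive′ (mkℚ (+ zero) _ _) = refl
      neg-involutive′ (mkℚ (+ suc _) _ _) = refl
      neg-involutive′ (mkℚ -[1+ _ ] _ _) = refl

  cube-mono⁺ : ∀ {p q} → 0ℚ ≤ p → p < q → cube p < cube q
  cube-mono⁺ {p} {q} 0≤p p<q = ≤-<-trans
    (*-monoʳ-≤ 0≤p (≤-trans (*-monoʳ-≤ 0≤p (<⇒≤ p<q)) (<⇒≤ (*-monoˡ-< 0<q p<q))))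
    (*-monoˡ-< (*-pos 0<q 0<q) p<q)
    where 0<q = ≤-<-trans 0≤p p<q

  cube-pos : ∀ {p} → 0ℚ < p → 0ℚ < cube p
  cube-pos 0<p = *-pos 0<p (*-pos 0<p 0<p)

  neg-cancel : ∀ {y z} → - z < - y → y < z
  neg-cancel {y} {z} h with <-cmp y z
  ... | tri< y<z _ _ = y<z
  ... | tri≈ _ refl _ = ⊥-elim (<-irrefl refl h)
  ... | tri> _ _ y>z = ⊥-elim (<-asym h (neg-antimono-< y>z))

  cube-mono : ∀ {p q} → p < q → cube p < cube q
  cube-mono {p} {q} p<q with 0ℚ ≤? p | 0ℚ <? q
  ... | yes 0≤p | _ = cube-mono⁺ 0≤p p<q
  ... | no 0≰p | yes 0<q = <-trans
    (neg-cancel (subst (0ℚ <_) (cube-neg p) (cube-pos (neg-antimono-< (≰⇒> 0≰p)))))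
    (cube-pos 0<q)
  ... | no _ | no 0≮q = neg-cancel
    (subst₂ _<_ (cube-neg q) (cube-neg p)
      (cube-mono⁺ (neg-antimono-≤ (≮⇒≥ 0≮q)) (neg-antimono-< p<q)))

  p≤cube : ∀ {p} → 1ℚ ≤ p → p ≤ cube p
  p≤cube {p} 1≤p = subst (_≤ cube p) (*-identityʳ p) (*-monoʳ-≤ 0≤p
    (≤-trans 1≤p (subst (_≤ p * p) (*-identityʳ p) (*-monoʳ-≤ 0≤p 1≤p))))
    where 0≤p = ≤-trans (<⇒≤ (positive⁻¹ 1ℚ)) 1≤p

-- The strict inequality with r makes the two cuts visibly open; by
-- continuity of cube it does not change them.
infix 8 ∛_
∛_ : ℝ⁺ → ℝ⁺
∛ y = record
  { real = record
    { Lower = λ q → ∃[ r ] q < r × Lower x (cube r)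
    ; Upper = λ q → ∃[ r ] r < q × Upper x (cube r)
    ; lower-inhabited = - 1ℚ , 0ℚ , negative⁻¹ (- 1ℚ) , 0<real y
    ; upper-inhabited = upperBound
    ; lower-closed = λ q<q′ (r , q′<r , l) → r , <-trans q<q′ q′<r , l
    ; upper-closed = λ q<q′ (r , r<q , u) → r , <-trans r<q q<q′ , u
    ; lower-open = λ (r , q<r , l) →
        let m , q<m , m<r = <-dense q<r in m , q<m , r , m<r , l
    ; upper-open = λ (r , r<q , u) →
        let m , r<m , m<q = <-dense r<q in m , m<q , r , r<m , u
    ; disjoint = λ (r , q<r , l) (s , s<q′ , u) →
        <-trans q<r (<-trans (cube-cancel (disjoint x l u)) s<q′)
    ; located = λ q<q′ →
        let m , q<m , m<q′ = <-dense q<q′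
            k , m<k , k<q′ = <-dense m<q′
        in [ (λ l → inj₁ (m , q<m , l)) , (λ u → inj₂ (k , k<q′ , u)) ]′
             (located x (cube-mono m<k))
    }
  ; 0<real =
      let a , 0<a , l = lower-open x (0<real y) in positiveBelow 0<a l
  }
  where
    x = real y

    cube-cancel : ∀ {p q} → cube p < cube q → p < q
    cube-cancel {p} {q} h with <-cmp p q
    ... | tri< p<q _ _ = p<q
    ... | tri≈ _ refl _ = ⊥-elim (<-irrefl refl h)
    ... | tri> _ _ p>q = ⊥-elim (<-asym h (cube-mono p>q))

    upperBound : ∃[ q ] ∃[ r ] r < q × Upper x (cube r)
    upperBound with u , xu ← upper-inhabited x =
      u + 1ℚ + 1ℚ , u + 1ℚ , p<p+1 (u + 1ℚ) ,
      upper-closed x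
        (<-≤-trans (p<p+1 u)
          (p≤cube (subst (_≤ u + 1ℚ) (+-identityˡ 1ℚ)
            (+-monoˡ-≤ 1ℚ (<⇒≤ (upper>0 y xu))))))
        xu

    positiveBelow : ∀ {a} → 0ℚ < a → Lower x a → ∃[ r ] 0ℚ < r × Lower x (cube r)
    positiveBelow {a} 0<a l with a <? 1ℚ
    ... | yes a<1 = a , 0<a , lower-closed x
            (subst (cube a <_) (*-identityʳ a)
              (*-monoʳ-< 0<a (<-trans
                (subst (a * a <_) (*-identityʳ a) (*-monoʳ-< 0<a a<1)) a<1))) l
    ... | no a≮1 = ½ , positive⁻¹ ½ ,
            lower-closed x (<-≤-trans half³<1 (≮⇒≥ a≮1)) l
      where
        half³<1 : cube ½ < 1ℚ
        half³<1 = *<* (+<+ (ℕ.s≤s (ℕ.s≤s ℕ.z≤n)))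

private
  fromℕ : ℕ → ℚ
  fromℕ n = + n / 1

  fromℕ≥0 : ∀ n → 0ℚ ≤ fromℕ n
  fromℕ≥0 n = nonNegative⁻¹ (fromℕ n) {{normalize-nonNeg n 1}}

-- For s > y > 0, q s < n gives q < n/s ≤ n/y, and dually for the upper cut.
infixl 7 _÷ᵣ_
_÷ᵣ_ : ℕ → ℝ⁺ → ℝ
n ÷ᵣ y = record
  { Lower = λ q → ∃[ s ] Upper x s × q * s < + n / 1
  ; Upper = λ q → ∃[ s ] 0ℚ < s × Lower x s × + n / 1 < q * s
  ; lower-inhabited =
      let s , u = upper-inhabited x
      in - 1ℚ , s , u ,
         <-≤-trans (subst (- 1ℚ * s <_) (*-zeroˡ s)
                     (*-monoˡ-< (upper>0 y u) (negative⁻¹ (- 1ℚ))))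
                   (fromℕ≥0 n)
  ; upper-inhabited =
      let s , 0<s , l = lower-open x (0<real y)
          t , e = divide (fromℕ n + 1ℚ) 0<s
      in t , s , 0<s , l , subst (fromℕ n <_) (sym e) (p<p+1 (fromℕ n))
  ; lower-closed = λ q<r (s , u , h) →
      s , u , <-trans (*-monoˡ-< (upper>0 y u) q<r) h
  ; upper-closed = λ q<r (s , 0<s , l , h) →
      s , 0<s , l , <-trans h (*-monoˡ-< 0<s q<r)
  ; lower-open = λ (s , u , h) →
      let 0<s = upper>0 y u
          m , qs<m , m<n = <-dense h
          t , e = divide m 0<s
      in t , *-cancelʳ-< 0<s (subst (_ <_) (sym e) qs<m)
           , s , u , subst (_< fromℕ n) (sym e) m<n
  ; upper-open = λ (s , 0<s , l , h) →
      let m , n<m , m<qs = <-dense h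
          t , e = divide m 0<s
      in t , *-cancelʳ-< 0<s (subst (_< _) (sym e) m<qs)
           , s , 0<s , l , subst (fromℕ n <_) (sym e) n<m
  ; disjoint = λ (s , u , qs<n) (t , 0<t , l , n<rt) →
      disj (disjoint x l u) 0<t qs<n n<rt
  ; located = loc (fromℕ≥0 n)
  }
  where
    x = real y
    ν = fromℕ n

    disj : ∀ {q r s t} → t < s → 0ℚ < t → q * s < ν → ν < r * t → q < r
    disj {q} {r} {s} {t} t<s 0<t qs<ν ν<rt with q <? r
    ... | yes q<r = q<r
    ... | no q≮r = ⊥-elim (<-asym qs<ν (<-≤-trans ν<rt
            (≤-trans (<⇒≤ (*-monoʳ-< 0<r t<s))
              (*-monoʳ-≤-nonNeg s {{nonNegative (<⇒≤ 0<s)}} (≮⇒≥ q≮r)))))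
      where
        0<s = <-trans 0<t t<s
        0<r : 0ℚ < r
        0<r = *-cancelʳ-< 0<t
          (subst (_< r * t) (sym (*-zeroˡ t)) (≤-<-trans (fromℕ≥0 n) ν<rt))

    loc : 0ℚ ≤ ν → ∀ {q r} → q < r →
          (∃[ s ] Upper x s × q * s < ν) ⊎
          (∃[ s ] 0ℚ < s × Lower x s × ν < r * s)
    loc 0≤ν {q} {r} q<r with 0ℚ ≤? q | 0ℚ <? ν
    ... | no 0≰q | _ =
      let s , u = upper-inhabited x
      in inj₁ (s , u , <-≤-trans
           (subst (q * s <_) (*-zeroˡ s) (*-monoˡ-< (upper>0 y u) (≰⇒> 0≰q))) 0≤ν)
    ... | yes 0≤q | no 0≮ν =
      let s , 0<s , l = lower-open x (0<real y)
      in inj₂ (s , 0<s , l ,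
           ≤-<-trans (≮⇒≥ 0≮ν) (*-pos (≤-<-trans 0≤q q<r) 0<s))
    ... | yes 0≤q | yes 0<ν =
      let m , q<m , m<r = <-dense q<r
          k , m<k , k<r = <-dense m<r
          0<m = ≤-<-trans 0≤q q<m
          0<k = <-trans 0<m m<k
          s , sk≡ν = divide ν 0<k
          t , tm≡ν = divide ν 0<m
          0<s = pos-quotient 0<k 0<ν sk≡ν
          0<t = pos-quotient 0<m 0<ν tm≡ν
          s<t = *-cancelʳ-< 0<m (subst (s * m <_) (trans sk≡ν (sym tm≡ν))
                  (*-monoʳ-< 0<s m<k))
      in [ (λ l → inj₂ (s , 0<s , l ,
             subst (_< r * s) (trans (*-comm k s) sk≡ν) (*-monoˡ-< 0<s k<r)))
         , (λ u → inj₁ (t , u ,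
             subst (q * t <_) (trans (*-comm m t) tm≡ν) (*-monoˡ-< 0<t q<m)))
         ]′ (located x s<t)

Increasing : Seq ℝ⁺ → Set
Increasing φ = ∀ X Y .{{_ : ℕ.NonZero X}} .{{_ : ℕ.NonZero Y}} →
               X ℕ.≤ Y → real (φ X) ≤ᵣ real (φ Y)

TendsTo∞ : Seq ℝ⁺ → Set
TendsTo∞ φ = ∀ (M : ℚ) →
  ∃[ N ] ∀ X .{{_ : ℕ.NonZero X}} → N ℕ.≤ X → Lower (real (φ X)) M

-- liminf a = sup_N inf_{X ≥ N} a X is an extended real, which need not be
-- located; it is represented by the set of rationals strictly above it.
-- It is less than +∞ exactly when that set is inhabited.
UpperCut : Set₁
UpperCut = Pred ℚ 0ℓ

infTail : Seq ℝ → ℕ → UpperCut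
infTail a N q =
  ∃[ X ] Σ[ X≢0 ∈ ℕ.NonZero X ] N ℕ.≤ X × Upper (a X {{X≢0}}) q

liminf : Seq ℝ → UpperCut
liminf a q = ∃[ p ] p < q × (∀ N → infTail a N p)

infix 4 _<∞
_<∞ : UpperCut → Set
c <∞ = ∃ c

{-# OPTIONS --safe #-}

-- Fix a very sparse sequence x₀ < x₁ < ⋯ and put x = xₖ, x′ = xₖ₊₁ = 8ᴶ.  Between
-- x and x′ the set A consists of the interval [x, x + 4·2ᴶ) and of the clusters
-- [4ʲ, 4ʲ + 2ʲ) with j < J, that is, of O(2ᴶ) = O(x′^⅓) elements.  Every n with
-- x ≤ n - 1 < x′ is represented: if n - 1 lies in the interval, as 1·(n - 1) + 1;
-- otherwise, with 8ʲ ≤ n - x < 8ʲ⁺¹, divide n - x by 4ʲ to get a quotient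
-- v ∈ [2ʲ, 2ʲ⁺³), and divide the remainder by v: n = v(4ʲ + q) + (x + t) with
-- q < 2ʲ and t < v.  So A² + A misses only 1, while A(xₖ) = O(xₖ^⅓) for k ≥ 1.
module Submission where

open import Defs
open import Data.Product.Base using (_×_; Σ-syntax)

open import Data.Empty using (⊥-elim)
open import Data.Integer.Base as ℤ using (+_)
import Data.Integer.Properties as ℤ
open import Data.List.Base using (List; []; _∷_; _++_; length; filter; applyUpTo; upTo)
open import Data.List.Membership.Propositional using () renaming (_∈_ to _∈ˡ_)
open import Data.List.Membership.Propositional.Properties
  using (∈-∃++; ∈-++⁺ˡ; ∈-++⁺ʳ; ∈-++⁻; ∈-applyUpTo⁺; ∈-applyUpTo⁻; ∈-filter⁻; ∈-upTo⁺)
open import Data.List.Properties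
  using (filter-all; filter-reject; length-applyUpTo; length-++; length-++-sucʳ)
open import Data.List.Relation.Binary.Subset.Propositional using (_⊆_)
import Data.List.Relation.Unary.All as All
import Data.List.Relation.Unary.All.Properties as All
open import Data.List.Relation.Unary.AllPairs using ([]; _∷_)
open import Data.List.Relation.Unary.Any using (here; there)
open import Data.List.Relation.Unary.Unique.Propositional using (Unique)
import Data.List.Relation.Unary.Unique.Propositional.Properties as Unique
open import Data.Nat.Base
open import Data.Nat.DivMod
open import Data.Nat.Properties
open import Data.Nat.Tactic.RingSolver using (solve-∀)
open import Data.Product.Base using (_,_; ∃-syntax)
open import Data.Rational.Base as ℚ using (ℚ; 0ℚ; 1ℚ)
import Data.Rational.Properties as ℚ
open import Data.Rational.Unnormalised.Base as ℚᵘ using (mkℚᵘ)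
import Data.Rational.Unnormalised.Properties as ℚᵘ
open import Data.Sum.Base using (_⊎_; inj₁; inj₂)
open import Function.Base using (_∘_)
open import Relation.Binary.PropositionalEquality
  using (_≡_; refl; sym; trans; cong; subst; module ≡-Reasoning)
open import Relation.Nullary using (¬_; yes; no)
open import Relation.Nullary.Decidable using (_×-dec_; _⊎-dec_)

-- Lists without repetition, bracketing, powers of 8

-- Induction on `xs`: deleting one occurrence of the head from `ys` loses no later element of `xs`,
-- since these all differ from the head.
unique-⊆⇒length≤ : ∀ {T : Set} {xs ys : List T} →
                   Unique xs → xs ⊆ ys → length xs ≤ length ys
unique-⊆⇒length≤ [] _ = z≤n
unique-⊆⇒length≤ {T} {x ∷ xs} (x∉xs ∷ xs!) sub
  with ps , qs , refl ← ∈-∃++ (sub (here refl)) = begin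
    suc (length xs)         ≤⟨ s≤s (unique-⊆⇒length≤ xs! sub′) ⟩
    suc (length (ps ++ qs)) ≡⟨ length-++-sucʳ ps x qs ⟨
    length (ps ++ x ∷ qs)   ∎
  where
    open ≤-Reasoning

    sub′ : xs ⊆ ps ++ qs
    sub′ z∈xs with ∈-++⁻ ps (sub (there z∈xs))
    ... | inj₁ z∈ps = ∈-++⁺ˡ z∈ps
    ... | inj₂ (here z≡x) = ⊥-elim (All.lookup x∉xs z∈xs (sym z≡x))
    ... | inj₂ (there z∈qs) = ∈-++⁺ʳ ps z∈qs

increasing⇒n≤f[n] : (f : ℕ → ℕ) → (∀ n → f n < f (suc n)) → ∀ n → n ≤ f n
increasing⇒n≤f[n] f f< zero = z≤n
increasing⇒n≤f[n] f f< (suc n) = ≤-<-trans (increasing⇒n≤f[n] f f< n) (f< n)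

-- Descending search from `m`: it stops at the first index whose value is at most `n`, and `f 0 ≤ n`
-- stops it in time.
bracket : (f : ℕ → ℕ) → ∀ {n} → f 0 ≤ n → ∀ m → n < f m →
          ∃[ k ] f k ≤ n × n < f (suc k)
bracket f f0≤n zero n<f0 = ⊥-elim (<⇒≱ n<f0 f0≤n)
bracket f {n} f0≤n (suc m) n<f[1+m] with f m ≤? n
... | yes fm≤n = m , fm≤n , n<f[1+m]
... | no fm≰n = bracket f f0≤n m (≰⇒> fm≰n)

8^<8^1+ : ∀ n → 8 ^ n < 8 ^ suc n
8^<8^1+ n = ^-monoʳ-< 8 (s≤s (s≤s z≤n)) (n<1+n n)

8^-cancel-< : ∀ {m n} → 8 ^ m < 8 ^ n → m < n
8^-cancel-< {m} {n} p with m <? n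
... | yes m<n = m<n
... | no m≮n = ⊥-elim (<⇒≱ p (^-monoʳ-≤ 8 (≮⇒≥ m≮n)))

^-distribʳ-* : ∀ m n o → (m * n) ^ o ≡ m ^ o * n ^ o
^-distribʳ-* m n zero = refl
^-distribʳ-* m n (suc o) =
  trans (cong (m * n *_) (^-distribʳ-* m n o)) (interchange m n (m ^ o) (n ^ o))
  where
    interchange : ∀ a b c d → a * b * (c * d) ≡ a * c * (b * d)
    interchange = solve-∀

8^≡2^*4^ : ∀ n → 8 ^ n ≡ 2 ^ n * 4 ^ n
8^≡2^*4^ n = ^-distribʳ-* 2 4 n

-- The set `A`

-- The growth rate makes 8^(3e) ≤ 2^e′ for consecutive exponents e, e′, so that
-- numbers beyond the dense interval only need 2ʲ ≥ 8ᵉ.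
exponent : ℕ → ℕ
exponent zero = 0
exponent (suc k) = suc (3 * (3 * exponent k))

stageStart : ℕ → ℕ
stageStart k = 8 ^ exponent k

-- The exact cube root 2ᴶ of the next stage start 8ᴶ.
width : ℕ → ℕ
width k = 2 ^ exponent (suc k)

-- The factor 4 makes room for all quotients below 8·2ʲ with j < J, as 8·2ʲ ≤ 4·2ᴶ.
denseEnd : ℕ → ℕ
denseEnd k = stageStart k + 4 * width k

InCluster : ℕ → ℕ → Set
InCluster j n = 4 ^ j ≤ n × n < 4 ^ j + 2 ^ j

-- The lower bound applies to the clusters too, which keeps later stages out of the count at an
-- earlier stage start.
InStage : ℕ → ℕ → Set
InStage k n =
  stageStart k ≤ n × (n < denseEnd k ⊎ ∃[ j ] j < exponent (suc k) × InCluster j n)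

exponent-< : ∀ k → exponent k < exponent (suc k)
exponent-< k = s≤s (≤-trans (m≤n*m (exponent k) 3) (m≤n*m (3 * exponent k) 3))

exponent-mono : ∀ {i k} → i ≤ k → exponent i ≤ exponent k
exponent-mono i≤k = go (≤⇒≤′ i≤k)
  where
    go : ∀ {i k} → i ≤′ k → exponent i ≤ exponent k
    go ≤′-refl = ≤-refl
    go (≤′-step p) = ≤-trans (go p) (<⇒≤ (exponent-< _))

stageStart-mono : ∀ {i k} → i ≤ k → stageStart i ≤ stageStart k
stageStart-mono = ^-monoʳ-≤ 8 ∘ exponent-mono

n<8^n : ∀ n → n < 8 ^ n
n<8^n zero = z<s
n<8^n (suc n) = ≤-<-trans (n<8^n n) (8^<8^1+ n)

k<stageStart : ∀ k → k < stageStart k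
k<stageStart k =
  ≤-<-trans (increasing⇒n≤f[n] exponent exponent-< k) (n<8^n (exponent k))

0<stageStart : ∀ k → 0 < stageStart k
0<stageStart k = ≤-<-trans z≤n (k<stageStart k)

stageStart≡2^ : ∀ k → stageStart k ≡ 2 ^ (3 * exponent k)
stageStart≡2^ k = ^-*-assoc 2 3 (exponent k)

8^[3e]≤width : ∀ k → 8 ^ (3 * exponent k) ≤ width k
8^[3e]≤width k = begin
  8 ^ (3 * exponent k)       ≡⟨ ^-*-assoc 2 3 (3 * exponent k) ⟩
  2 ^ (3 * (3 * exponent k)) ≤⟨ ^-monoʳ-≤ 2 (n≤1+n (3 * (3 * exponent k))) ⟩
  width k                    ∎
  where open ≤-Reasoning

-- The bound `k < n` makes membership a finite search and `n` positive; `k<stageStart` supplies it.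
A : ℕ⁺Set
A = record
  { Member = λ n → ∃[ k ] k < n × InStage k n
  ; member? = λ n → anyUpTo? (λ k → stageStart k ≤? n ×-dec
      (n <? denseEnd k ⊎-dec
       anyUpTo? (λ j → 4 ^ j ≤? n ×-dec n <? 4 ^ j + 2 ^ j) (exponent (suc k)))) n
  ; nonZero⁺ = λ (_ , k<n , _) → >-nonZero (≤-<-trans z≤n k<n)
  }

inStage⇒∈A : ∀ k {n} → InStage k n → n ∈ A
inStage⇒∈A k st@(x≤n , _) = k , <-≤-trans (k<stageStart k) x≤n , st

dense⇒∈A : ∀ k {n} → stageStart k ≤ n → n < denseEnd k → n ∈ A
dense⇒∈A k p q = inStage⇒∈A k (p , inj₁ q)

1∈A : 1 ∈ A
1∈A = dense⇒∈A 0 ≤-refl (s≤s (s≤s z≤n))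

-- Representing every n ≥ 2

cover-beyond-dense : ∀ k m → 4 * width k ≤ m → m < stageStart (suc k) →
                     stageStart k + m ∈ A ² ⊕ A
cover-beyond-dense k m 4w≤m m<x′
  with j , 8^j≤m , m<8^1+j ← bracket (8 ^_)
         (≤-trans (*-mono-≤ {1} {4} (s≤s z≤n) (m^n>0 2 (exponent (suc k)))) 4w≤m)
         (exponent (suc k)) m<x′ =
  v * u , x + t , (v , u , v∈A , u∈A , refl) , c∈A , eq
  where
    x = stageStart k
    J = exponent (suc k)

    instance
      4^j≢0 : NonZero (4 ^ j)
      4^j≢0 = m^n≢0 4 j

    j<J : j < J
    j<J = 8^-cancel-< (≤-<-trans 8^j≤m m<x′)

    -- The growth of `exponent` enters here: 8^(3e) ≤ w ≤ m < 8ʲ⁺¹. Hence 2ʲ ≥ 8ᵉ = x, which places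
    -- `v` and `u` beyond the start of the stage.
    3e≤j : 3 * exponent k ≤ j
    3e≤j = m<1+n⇒m≤n (8^-cancel-< (≤-<-trans
      (≤-trans (≤-trans (8^[3e]≤width k) (m≤n*m (width k) 4)) 4w≤m) m<8^1+j))

    x≤2^j : x ≤ 2 ^ j
    x≤2^j = subst (_≤ 2 ^ j) (sym (stageStart≡2^ k)) (^-monoʳ-≤ 2 3e≤j)

    v = m / 4 ^ j
    r = m % 4 ^ j

    2^j≤v : 2 ^ j ≤ v
    2^j≤v = subst (_≤ v) (m*n/n≡m (2 ^ j) (4 ^ j))
      (/-monoˡ-≤ (4 ^ j) (subst (_≤ m) (8^≡2^*4^ j) 8^j≤m))

    v<8*2^j : v < 8 * 2 ^ j
    v<8*2^j = m<n*o⇒m/o<n (subst (m <_)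
      (trans (cong (8 *_) (8^≡2^*4^ j)) (sym (*-assoc 8 (2 ^ j) (4 ^ j)))) m<8^1+j)

    v<4w : v < 4 * width k
    v<4w = <-≤-trans v<8*2^j (≤-trans (≤-reflexive (*-assoc 4 2 (2 ^ j)))
      (*-monoʳ-≤ 4 (^-monoʳ-≤ 2 j<J)))

    instance
      v≢0 : NonZero v
      v≢0 = >-nonZero (<-≤-trans (m^n>0 2 j) 2^j≤v)

    q = r / v
    t = r % v
    u = 4 ^ j + q

    -- r < 4ʲ = 2ʲ·2ʲ ≤ 2ʲ·v, so `u` stays within the j-th cluster.
    q<2^j : q < 2 ^ j
    q<2^j = m<n*o⇒m/o<n (<-≤-trans (m%n<n m (4 ^ j))
      (≤-trans (≤-reflexive (^-distribʳ-* 2 2 j)) (*-monoʳ-≤ (2 ^ j) 2^j≤v)))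

    v∈A : v ∈ A
    v∈A = dense⇒∈A k (≤-trans x≤2^j 2^j≤v) (<-≤-trans v<4w (m≤n+m _ x))

    u∈A : u ∈ A
    u∈A = inStage⇒∈A k
      ( ≤-trans x≤2^j (≤-trans (^-monoˡ-≤ j (s≤s (s≤s z≤n))) (m≤m+n _ q))
      , inj₂ (j , j<J , m≤m+n _ q , +-monoʳ-< (4 ^ j) q<2^j))

    c∈A : x + t ∈ A
    c∈A = dense⇒∈A k (m≤m+n x t) (+-monoʳ-< x (<-trans (m%n<n r v) v<4w))

    rearrange : ∀ v p q x t → v * (p + q) + (x + t) ≡ x + ((t + q * v) + v * p)
    rearrange = solve-∀

    eq : v * u + (x + t) ≡ x + m
    eq = trans (rearrange v (4 ^ j) q x t)
      (cong (λ z → x + z) (trans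
        (cong (_+ v * 4 ^ j) (sym (m≡m%n+[m/n]*n r v)))
        (sym (m≡m%n+[m/n]*n m (4 ^ j)))))

-- The predecessor is bracketed: in the interval it gives 1·n + 1, and otherwise x ≥ 1 yields suc n
-- - x ≤ n < x′.
2≤n⇒n∈A²⊕A : ∀ n → 2 ≤ n → n ∈ A ² ⊕ A
2≤n⇒n∈A²⊕A (suc n) (s≤s 1≤n)
  with k , x≤n , n<x′ ← bracket stageStart 1≤n n (k<stageStart n)
  with n <? denseEnd k
... | yes n<y =
  n , 1 , (1 , n , 1∈A , dense⇒∈A k x≤n n<y , *-identityˡ n) , 1∈A , +-comm n 1
... | no n≮y = subst (_∈ A ² ⊕ A) x+m≡1+n
  (cover-beyond-dense k m
    (+-cancelˡ-≤ x _ _ (subst (denseEnd k ≤_) (sym x+m≡1+n) (m≤n⇒m≤1+n (≮⇒≥ n≮y))))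
    (≤-<-trans (∸-monoʳ-≤ (suc n) (0<stageStart k)) n<x′))
  where
    x = stageStart k
    m = suc n ∸ x
    x+m≡1+n : x + m ≡ suc n
    x+m≡1+n = m+[n∸m]≡n (m≤n⇒m≤1+n x≤n)

-- Counting `A ² ⊕ A` and `A`

1∉A²⊕A : ¬ (1 ∈ A ² ⊕ A)
1∉A²⊕A (p , c , p∈ , c∈ , p+c≡1) = <-irrefl (sym p+c≡1)
  (+-mono-≤ (>-nonZero⁻¹ p {{ℕ⁺Set.nonZero⁺ (A ²) p∈}})
            (>-nonZero⁻¹ c {{ℕ⁺Set.nonZero⁺ A c∈}}))

count-misses-1 : ∀ S → ¬ (1 ∈ S) → (∀ n → 2 ≤ n → n ∈ S) →
                 ∀ n → count S (suc n) ≡ n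
count-misses-1 S 1∉S 2≤n⇒n∈S n = begin
  length (filter S? (1 ∷ tail))  ≡⟨ cong length (filter-reject S? {xs = tail} 1∉S) ⟩
  length (filter S? tail)        ≡⟨ cong length (filter-all S? tail∈S) ⟩
  length tail                    ≡⟨ length-applyUpTo _ n ⟩
  n                              ∎
  where
    open ≡-Reasoning
    S? = ℕ⁺Set.member? S
    tail = applyUpTo (suc ∘ suc) n
    tail∈S = All.applyUpTo⁺₂ (suc ∘ suc) n λ i → 2≤n⇒n∈S (2+ i) (s≤s (s≤s z≤n))

-- The counted list has no repetitions, so `cs` may contain repetitions and extra elements.
count-≤ : ∀ S X cs → (∀ {n} → n ∈ S → n ≤ X → n ∈ˡ cs) → count S X ≤ length cs
count-≤ S X cs covered = unique-⊆⇒length≤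
  (Unique.filter⁺ S? (Unique.applyUpTo⁺₁ suc X λ i<j _ → <⇒≢ (s≤s i<j)))
  λ n∈ → let n∈[1,X] , n∈S = ∈-filter⁻ S? {xs = applyUpTo suc X} n∈
             i , i<X , n≡1+i = ∈-applyUpTo⁻ suc n∈[1,X]
         in covered n∈S (subst (_≤ X) (sym n≡1+i) i<X)
  where S? = ℕ⁺Set.member? S

clusters : ℕ → List ℕ
clusters zero = []
clusters (suc j) = clusters j ++ applyUpTo (λ i → 4 ^ j + i) (2 ^ j)

-- 1 + 2 + ⋯ + 2ʲ⁻¹ = 2ʲ - 1. The strictness later pays for the single candidate
-- `stageStart (suc k)`.
length-clusters : ∀ j → length (clusters j) < 2 ^ j
length-clusters zero = s≤s z≤n
length-clusters (suc j) = begin-strict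
  length (clusters j ++ applyUpTo (λ i → 4 ^ j + i) (2 ^ j))
    ≡⟨ length-++ (clusters j) ⟩
  length (clusters j) + length (applyUpTo (λ i → 4 ^ j + i) (2 ^ j))
    ≡⟨ cong (λ z → length (clusters j) + z) (length-applyUpTo _ (2 ^ j)) ⟩
  length (clusters j) + 2 ^ j
    <⟨ +-monoˡ-< (2 ^ j) (length-clusters j) ⟩
  2 ^ j + 2 ^ j
    ≡⟨ cong (λ z → 2 ^ j + z) (+-identityʳ (2 ^ j)) ⟨
  2 ^ suc j ∎
  where open ≤-Reasoning

∈-clusters : ∀ {j J n} → j < J → InCluster j n → n ∈ˡ clusters J
∈-clusters {j} {suc J} {n} j<1+J c@(4^j≤n , n<) with m<1+n⇒m<n∨m≡n j<1+J
... | inj₁ j<J = ∈-++⁺ˡ (∈-clusters j<J c)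
... | inj₂ refl = ∈-++⁺ʳ (clusters j)
  (subst (_∈ˡ applyUpTo (λ i → 4 ^ j + i) (2 ^ j)) (m+[n∸m]≡n 4^j≤n)
    (∈-applyUpTo⁺ _ (+-cancelˡ-< (4 ^ j) _ _
      (subst (_< 4 ^ j + 2 ^ j) (sym (m+[n∸m]≡n 4^j≤n)) n<))))

denseEnd-mono : ∀ {i k} → i ≤ k → denseEnd i ≤ denseEnd k
denseEnd-mono i≤k = +-mono-≤ (stageStart-mono i≤k)
  (*-monoʳ-≤ 4 (^-monoʳ-≤ 2 (exponent-mono (s≤s i≤k))))

stageStart≤width : ∀ k → stageStart k ≤ width k
stageStart≤width k = ≤-trans (^-monoʳ-≤ 8 (m≤n*m (exponent k) 3)) (8^[3e]≤width k)

-- The initial segment absorbs the intervals of all stages up to `k`.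
candidates : ℕ → List ℕ
candidates k = upTo (denseEnd k) ++ stageStart (suc k) ∷ clusters (exponent (suc k))

∈A⇒candidate : ∀ k {n} → n ∈ A → n ≤ stageStart (suc k) → n ∈ˡ candidates k
∈A⇒candidate k {n} (i , _ , x≤n , in?) n≤X with i ≤? k
-- A later stage starts at `stageStart (suc k)` or beyond, so `n` can only be that endpoint.
... | no i≰k = ∈-++⁺ʳ _ (here (≤-antisym n≤X (≤-trans (stageStart-mono (≰⇒> i≰k)) x≤n)))
... | yes i≤k with in?
...   | inj₁ n<y = ∈-++⁺ˡ (∈-upTo⁺ (<-≤-trans n<y (denseEnd-mono i≤k)))
...   | inj₂ (j , j<J , c) = ∈-++⁺ʳ _ (there
          (∈-clusters (<-≤-trans j<J (exponent-mono (s≤s i≤k))) c))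

length-candidates : ∀ k → length (candidates k) ≤ 6 * width k
length-candidates k = begin
  length (candidates k)              ≡⟨ length-++ (upTo (denseEnd k)) ⟩
  length (upTo (denseEnd k)) + suc (length (clusters (exponent (suc k))))
    ≤⟨ +-mono-≤ (≤-reflexive (length-applyUpTo _ (denseEnd k)))
                (length-clusters (exponent (suc k))) ⟩
  stageStart k + 4 * width k + width k    ≤⟨ +-monoˡ-≤ _ (+-monoˡ-≤ _ (stageStart≤width k)) ⟩
  width k + 4 * width k + width k    ≡⟨ collect (width k) ⟩
  6 * width k                        ∎
  where
    open ≤-Reasoning
    collect : ∀ w → w + 4 * w + w ≡ 6 * w
    collect = solve-∀

0<width : ∀ k → 0 < width k
0<width k = m^n>0 2 (exponent (suc k))

count-A : ∀ k → count A (stageStart (suc k)) < 8 * width k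
count-A k = begin-strict
  count A (stageStart (suc k)) ≤⟨ count-≤ A _ (candidates k) (∈A⇒candidate k) ⟩
  length (candidates k)        ≤⟨ length-candidates k ⟩
  -- Relaxing 6 to 8 gives the strict bound that the upper cut of a quotient requires.
  6 * width k                  <⟨ *-monoˡ-< (width k) {{>-nonZero (0<width k)}} {6} {8}
                                    (m<m+n 6 (s≤s z≤n)) ⟩
  8 * width k                  ∎
  where open ≤-Reasoning

-- Rational arithmetic

-- `+ n / suc d` is by definition `fromℚᵘ (mkℚᵘ (+ n) d)`, so facts about fractions can be checked
-- before reduction to lowest terms.
fromℚᵘ-mono-< : ∀ {p q} → p ℚᵘ.< q → ℚ.fromℚᵘ p ℚ.< ℚ.fromℚᵘ q
fromℚᵘ-mono-< {p} {q} p<q = ℚ.toℚᵘ-cancel-<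
  (ℚᵘ.<-respˡ-≃ (ℚᵘ.≃-sym (ℚ.toℚᵘ-fromℚᵘ p))
    (ℚᵘ.<-respʳ-≃ (ℚᵘ.≃-sym (ℚ.toℚᵘ-fromℚᵘ q)) p<q))

fromℚᵘ-homo-+ : ∀ p q → ℚ.fromℚᵘ p ℚ.+ ℚ.fromℚᵘ q ≡ ℚ.fromℚᵘ (p ℚᵘ.+ q)
fromℚᵘ-homo-+ p q = ℚ.toℚᵘ-injective
  (ℚᵘ.≃-trans (ℚ.toℚᵘ-homo-+ (ℚ.fromℚᵘ p) (ℚ.fromℚᵘ q))
    (ℚᵘ.≃-trans (ℚᵘ.+-cong (ℚ.toℚᵘ-fromℚᵘ p) (ℚ.toℚᵘ-fromℚᵘ q))
      (ℚᵘ.≃-sym (ℚ.toℚᵘ-fromℚᵘ (p ℚᵘ.+ q)))))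

fromℚᵘ-homo-* : ∀ p q → ℚ.fromℚᵘ p ℚ.* ℚ.fromℚᵘ q ≡ ℚ.fromℚᵘ (p ℚᵘ.* q)
fromℚᵘ-homo-* p q = ℚ.toℚᵘ-injective
  (ℚᵘ.≃-trans (ℚ.toℚᵘ-homo-* (ℚ.fromℚᵘ p) (ℚ.fromℚᵘ q))
    (ℚᵘ.≃-trans (ℚᵘ.*-cong (ℚ.toℚᵘ-fromℚᵘ p) (ℚ.toℚᵘ-fromℚᵘ q))
      (ℚᵘ.≃-sym (ℚ.toℚᵘ-fromℚᵘ (p ℚᵘ.* q)))))

ι : ℕ → ℚ
ι n = + n ℚ./ 1

ι-mono-< : ∀ {m n} → m < n → ι m ℚ.< ι n
ι-mono-< {m} {n} m<n = fromℚᵘ-mono-< {mkℚᵘ (+ m) 0} {mkℚᵘ (+ n) 0}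
  (ℚᵘ.*<* (ℤ.*-monoʳ-<-pos (+ 1) (ℤ.+<+ m<n)))

ι-homo-* : ∀ m n → ι m ℚ.* ι n ≡ ι (m * n)
ι-homo-* m n = trans (fromℚᵘ-homo-* (mkℚᵘ (+ m) 0) (mkℚᵘ (+ n) 0))
  (cong (ℚ._/ 1) (sym (ℤ.pos-* m n)))

-- The cuts of `X ·ᵣ y` are those of `y` after multiplication by `+ 1 / X`.
ι[n*X]*1/X≡ι[n] : ∀ n X .{{_ : NonZero X}} → ι (n * X) ℚ.* (+ 1 ℚ./ X) ≡ ι n
ι[n*X]*1/X≡ι[n] n X@(suc p) =
  trans (fromℚᵘ-homo-* (mkℚᵘ (+ (n * X)) 0) (mkℚᵘ (+ 1) p))
        (ℚ.fromℚᵘ-cong {mkℚᵘ (+ (n * X)) 0 ℚᵘ.* mkℚᵘ (+ 1) p} {mkℚᵘ (+ n) 0}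
          (ℚᵘ.*≡* (begin
    + (n * X) ℤ.* + 1 ℤ.* + 1 ≡⟨ ℤ.*-identityʳ _ ⟩
    + (n * X) ℤ.* + 1         ≡⟨ ℤ.*-identityʳ _ ⟩
    + (n * X)                 ≡⟨ ℤ.pos-* n X ⟩
    + n ℤ.* + X               ≡⟨ cong (+ n ℤ.*_) (ℤ.*-identityˡ (+ X)) ⟨
    + n ℤ.* (+ 1 ℤ.* + X)     ∎)))
  where open ≡-Reasoning

cube-ι : ∀ n → cube (ι n) ≡ ι (n * (n * n))
cube-ι n = trans (cong (ι n ℚ.*_) (ι-homo-* n n)) (ι-homo-* n (n * n))

[2*width]³≡8*stageStart :
  ∀ k → (2 * width k) * ((2 * width k) * (2 * width k)) ≡ 8 * stageStart (suc k)
[2*width]³≡8*stageStart k = begin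
  (2 * w) * ((2 * w) * (2 * w)) ≡⟨ collect w ⟩
  8 * (w * (w * w))             ≡⟨ cong (λ z → 8 * (w * z)) (^-distribʳ-* 2 2 e) ⟨
  8 * (w * 4 ^ e)               ≡⟨ cong (8 *_) (8^≡2^*4^ e) ⟨
  8 * stageStart (suc k)        ∎
  where
    open ≡-Reasoning
    w = width k
    e = exponent (suc k)
    collect : ∀ w → (2 * w) * ((2 * w) * (2 * w)) ≡ 8 * (w * (w * w))
    collect = solve-∀

-- Density one

-- Writing 1 as n/(1+n) + 1/(1+n) leaves only -1/(1+n) inside the absolute value.
∣n/[1+n]-1∣≡1/[1+n] : ∀ n → ℚ.∣ + n ℚ./ suc n ℚ.- 1ℚ ∣ ≡ + 1 ℚ./ suc n
∣n/[1+n]-1∣≡1/[1+n] n = begin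
  ℚ.∣ a ℚ.- 1ℚ ∣          ≡⟨ cong (λ z → ℚ.∣ a ℚ.- z ∣) a+b≡1 ⟨
  ℚ.∣ a ℚ.- (a ℚ.+ b) ∣   ≡⟨ cong ℚ.∣_∣ a-[a+b]≡-b ⟩
  ℚ.∣ ℚ.- b ∣             ≡⟨ ℚ.∣-p∣≡∣p∣ b ⟩
  ℚ.∣ b ∣                 ≡⟨ ℚ.0≤p⇒∣p∣≡p 0≤b ⟩
  b                       ∎
  where
    open ≡-Reasoning
    a = + n ℚ./ suc n
    b = + 1 ℚ./ suc n
    0≤b = ℚ.nonNegative⁻¹ b {{ℚ.normalize-nonNeg 1 (suc n)}}

    a+b≡1 : a ℚ.+ b ≡ 1ℚ
    a+b≡1 = trans (fromℚᵘ-homo-+ (mkℚᵘ (+ n) n) (mkℚᵘ (+ 1) n))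
      (ℚ.fromℚᵘ-cong {mkℚᵘ (+ n) n ℚᵘ.+ mkℚᵘ (+ 1) n} {mkℚᵘ (+ 1) 0}
        (ℚᵘ.*≡* (begin
        (+ n ℤ.* + suc n ℤ.+ + 1 ℤ.* + suc n) ℤ.* + 1 ≡⟨ ℤ.*-identityʳ _ ⟩
        + n ℤ.* + suc n ℤ.+ + 1 ℤ.* + suc n           ≡⟨ ℤ.*-distribʳ-+ (+ suc n) (+ n) (+ 1) ⟨
        (+ n ℤ.+ + 1) ℤ.* + suc n   ≡⟨ cong (λ z → + z ℤ.* + suc n) (+-comm n 1) ⟩
        + suc n ℤ.* + suc n         ≡⟨ ℤ.*-identityˡ _ ⟨
        + 1 ℤ.* (+ suc n ℤ.* + suc n) ∎)))

    a-[a+b]≡-b : a ℚ.- (a ℚ.+ b) ≡ ℚ.- b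
    a-[a+b]≡-b = begin
      a ℚ.- (a ℚ.+ b)           ≡⟨ cong (a ℚ.+_) (ℚ.neg-distrib-+ a b) ⟩
      a ℚ.+ (ℚ.- a ℚ.+ ℚ.- b)   ≡⟨ ℚ.+-assoc a (ℚ.- a) (ℚ.- b) ⟨
      a ℚ.- a ℚ.+ ℚ.- b         ≡⟨ cong (ℚ._+ ℚ.- b) (ℚ.+-inverseʳ a) ⟩
      0ℚ ℚ.+ ℚ.- b              ≡⟨ ℚ.+-identityˡ (ℚ.- b) ⟩
      ℚ.- b                     ∎

-- A positive rational (1+a)/(1+d) is at least 1/(1+d), so N = 1+d suffices.
1/n-eventually-< : ∀ ε → 0ℚ ℚ.< ε → ∃[ N ] ∀ n → N ≤ n → + 1 ℚ./ suc n ℚ.< ε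
1/n-eventually-< ε@(ℚ.mkℚ (+ suc a) d _) _ = suc d , λ n d<n →
  subst (+ 1 ℚ./ suc n ℚ.<_) (ℚ.fromℚᵘ-toℚᵘ ε)
    (fromℚᵘ-mono-< {mkℚᵘ (+ 1) n} {mkℚᵘ (+ suc a) d} (ℚᵘ.*<* (ℤ.+<+
      (≤-<-trans (≤-reflexive (*-identityˡ (suc d)))
        (<-≤-trans (s≤s d<n) (m≤n*m (suc n) (suc a)))))))
1/n-eventually-< (ℚ.mkℚ (+ zero) _ _) (ℚ.*<* (ℤ.+<+ ()))
1/n-eventually-< (ℚ.mkℚ ℤ.-[1+ _ ] _ _) (ℚ.*<* ())

misses-1⇒densityOne : ∀ S → ¬ (1 ∈ S) → (∀ n → 2 ≤ n → n ∈ S) → HasDensityOne S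
misses-1⇒densityOne S 1∉S 2≤n⇒n∈S ε 0<ε
  with N , small ← 1/n-eventually-< ε 0<ε =
  suc N , λ { (suc n) (s≤s N≤n) →
    subst (ℚ._< ε) (sym (trans
        (cong (λ c → ℚ.∣ + c ℚ./ suc n ℚ.- 1ℚ ∣) (count-misses-1 S 1∉S 2≤n⇒n∈S n))
        (∣n/[1+n]-1∣≡1/[1+n] n)))
      (small n N≤n) }

-- Finiteness of the liminf

-- From y > 8 one gets X y > 8 X = (2 w)³; the lower cut of ∛ needs room below the
-- root 2 w, and w is used.
÷∛-upper : ∀ (y : ℝ⁺) {c w X} .{{_ : NonZero X}} → 0 < w →
           (2 * w) * ((2 * w) * (2 * w)) ≡ 8 * X → c < 8 * w →
           ℝ.Lower (ℝ⁺.real y) (ι 8) → ℝ.Upper (c ÷ᵣ ∛ (X ·ᵣ y)) (ι 8)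
÷∛-upper y {c} {w} {X} 0<w [2w]³≡8X c<8w 8<y =
  ι w , ι-mono-< 0<w ,
  (ι (2 * w) , ι-mono-< w<2w ,
   subst (ℝ.Lower (ℝ⁺.real y)) (sym cube≡8) 8<y) ,
  subst (ι c ℚ.<_) (sym (ι-homo-* 8 w)) (ι-mono-< c<8w)
  where
    w<2w : w < 2 * w
    w<2w = subst (w <_) (cong (λ z → w + z) (sym (+-identityʳ w))) (m<m+n w 0<w)

    cube≡8 : cube (ι (2 * w)) ℚ.* (+ 1 ℚ./ X) ≡ ι 8
    cube≡8 = trans
      (cong (ℚ._* (+ 1 ℚ./ X)) (trans (cube-ι (2 * w)) (cong ι [2w]³≡8X)))
      (ι[n*X]*1/X≡ι[n] 8 X)

cubeRoot-sparse⇒liminf<∞ :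
  ∀ S (X w : ℕ → ℕ) → (∀ k → k ≤ X k) → (∀ k → 0 < w k) →
  (∀ k → (2 * w k) * ((2 * w k) * (2 * w k)) ≡ 8 * X k) →
  (∀ k → count S (X k) < 8 * w k) →
  (φ : Seq ℝ⁺) → TendsTo∞ φ → liminf (λ X → count S X ÷ᵣ ∛ (X ·ᵣ φ X)) <∞
cubeRoot-sparse⇒liminf<∞ S X w k≤X 0<w [2w]³≡8X count<8w φ φ→∞
  -- Every tail contains a ratio below 8; `liminf` asks for a rational strictly above 8, hence 9.
  with N₀ , φ≥8 ← φ→∞ (ι 8) = ι 9 , ι 8 , ι-mono-< (n<1+n 8) , tail
  where
    0<X : ∀ k → 0 < X k
    0<X k = n≢0⇒n>0 λ X≡0 → <⇒≢ 0<[2w]³ (sym (trans ([2w]³≡8X k) (cong (8 *_) X≡0)))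
      where
        0<2w = *-mono-< {0} {2} (s≤s z≤n) (0<w k)
        0<[2w]³ = *-mono-< 0<2w (*-mono-< 0<2w 0<2w)

    tail : ∀ N → infTail (λ X → count S X ÷ᵣ ∛ (X ·ᵣ φ X)) N (ι 8)
    tail N = X k , X≢0 , ≤-trans (m≤m+n N N₀) (k≤X k) ,
      ÷∛-upper (φ (X k)) {count S (X k)} {w k} {X k} (0<w k) ([2w]³≡8X k) (count<8w k)
        (φ≥8 (X k) (≤-trans (m≤n+m N₀ N) (k≤X k)))
      where
        -- Large enough both to reach the tail from `N` and to have φ above 8.
        k = N + N₀
        instance
          X≢0 : NonZero (X k)
          X≢0 = >-nonZero (0<X k)

theorem1p3 : (φ : Seq ℝ⁺) → Increasing φ → TendsTo∞ φ →
    Σ[ A ∈ ℕ⁺Set ] (HasDensityOne (A ² ⊕ A) × liminf (λ X → count A X ÷ᵣ ∛ (X ·ᵣ φ X)) <∞)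
theorem1p3 φ _ φ→∞ = A , misses-1⇒densityOne (A ² ⊕ A) 1∉A²⊕A 2≤n⇒n∈A²⊕A ,
  -- The sample points begin with stage 1, because `width k` is the cube root of the start of stage
  -- k + 1.
  cubeRoot-sparse⇒liminf<∞ A (stageStart ∘ suc) width
    (λ k → <⇒≤ (<-trans (n<1+n k) (k<stageStart (suc k))))
    0<width [2*width]³≡8*stageStart count-A φ φ→∞
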